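{- Let $n\geq 1$, let $p(\overline{x_n})$ be a polynomial with integer coefficients in the unknowns $x_1,\ldots,x_n$, let $F$ be a function variable of arity $n$, and let $(\mathcal{U},\mathcal{A},F)$ be the ASOGU problem induced by $p(\overline{x_n})$, where $\mathcal{U}=\{\mathrm{cvt}[F,p(\overline{x_n})]^-\stackrel{?}{=}_F\mathrm{cvt}[F,p(\overline{x_n})]^+\}$. Then $$p(\overline{x_n})=\mathrm{cnt}[F,\overline{x_n},a,\mathcal{U}]_r-\mathrm{cnt}[F,\overline{x_n},a,\mathcal{U}]_l\qquad\text{and}\qquad 0=\mathrm{mul}[F,\overline{x_n},\mathcal{U}]_l-\mathrm{mul}[F,\overline{x_n},\mathcal{U}]_r.$$
   Context: The signature $\Sigma$ is finite and contains a binary symbol $g$ and a constant $a$; $\mathcal{A}=\{g(x,g(y,z))=g(g(x,y),z)\}$. Terms are written in flattened form: $g(u_1,\ldots,u_m)$ with $m\geq 2$ stands for a nested application of $g$ to $u_1,\ldots,u_m$ in this order (say right-nested), and $a^k$ stands for a sequence of $k$ copies of $a$. A function variable $F$ of arity $n$ is applied to $n$ argument terms. $\overline{x_n}$ abbreviates $x_1,\ldots,x_n$. Monomial groupings. Polynomials are in reduced form (a sum of monomials, like terms combined), with integer coefficients. For each polynomial $p(\overline{x_n})$ a total linear order $<_p$ on $x_1,\ldots,x_n$ is fixed. $p_0\in\mathbb{Z}$ denotes the constant term of $p$. For $1\leq j\leq n$, $p_{x_j}$ is the sum of those monomials of $p$ that are divisible by $x_j$ and not divisible by any $x_i$ with $x_i<_p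 x_j$ (and $p_{x_j}=0$ if there are none). Writing $p_{x_j}=x_j\cdot p'$, the reduction is $p_{x_j}\!\downarrow\;=p'$. $n$-converter. The terms $\mathrm{cvt}[F,p]^+$ and $\mathrm{cvt}[F,p]^-$ are defined recursively. If $p=c$ is constant: $\mathrm{cvt}[F,p]^+=g(a^{c+1})$ if $c\geq 1$ and $\mathrm{cvt}[F,p]^+=a$ if $c\leq 0$; $\mathrm{cvt}[F,p]^-=g(a^{|c|+1})$ if $c<0$ and $\mathrm{cvt}[F,p]^-=a$ if $c\geq 0$. If $p\neq p_0$, put $c=p_0$ and, for $\star\in\{+,-\}$ and $1\leq i\leq n$, $t_i^\star=\mathrm{cvt}[F,p_{x_i}\!\downarrow]^\star$; then $\mathrm{cvt}[F,p]^+=g(a^{c},F(t_1^+,\ldots,t_n^+))$ if $c\geq 1$ and $\mathrm{cvt}[F,p]^+=F(t_1^+,\ldots,t_n^+)$ if $c\leq 0$; $\mathrm{cvt}[F,p]^-=g(a^{|c|},F(t_1^-,\ldots,t_n^-))$ if $c<0$ and $\mathrm{cvt}[F,p]^-=F(t_1^-,\ldots,t_n^-)$ if $c\geq 0$. The ASOGU (associative second-order ground unification) problem induced by $p$ is $(\mathcal{U},\mathcal{A},F)$ with $\mathcal{U}=\{\mathrm{cvt}[F,p]^-\stackrel{?}{=}_F\mathrm{cvt}[F,p]^+\}$. Multiplier and counter (for $\overline{h_n}=h_1,\ldots,h_n$ non-negative integers, or, as here, the unknowns $x_1,\ldots,x_n$ themselves ranging over the natural numbers, so that the values are polynomials in $\overline{x_n}$).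 $\mathrm{mul}[F,\overline{h_n},t]$ is $0$ if $t$ is a constant; $\mathrm{mul}[F,\overline{h_n},f(t_1,\ldots,t_l)]=\sum_{j}\mathrm{mul}[F,\overline{h_n},t_j]$ for $f\in\Sigma$; $\mathrm{mul}[F,\overline{h_n},F(t_1,\ldots,t_n)]=1+\sum_{i=1}^n h_i\cdot\mathrm{mul}[F,\overline{h_n},t_i]$. For $b\in\Sigma$ and $f\in\Sigma$ of arity $l\geq 0$, $\mathrm{cnt}[F,\overline{h_n},b,f(t_1,\ldots,t_l)]=\delta+\sum_{j=1}^l\mathrm{cnt}[F,\overline{h_n},b,t_j]$ with $\delta=1$ if $f=b$ and $\delta=0$ otherwise; $\mathrm{cnt}[F,\overline{h_n},b,F(t_1,\ldots,t_n)]=\sum_{i=1}^n h_i\cdot\mathrm{cnt}[F,\overline{h_n},b,t_i]$. For a set $\mathcal{U}$ of equations, the subscript $l$ (resp. $r$) denotes the sum of the corresponding values over all left-hand (resp. right-hand) sides of the equations in $\mathcal{U}$. -}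

module Defs where

open import Level using (Level; 0ℓ)
open import Algebra.Bundles.Raw using (RawSemiring)
open import Data.Fin using (Fin; zero; suc)
import Data.Fin.Properties as Fin
open import Data.Integer using (ℤ; +[1+_]; -[1+_]; 0ℤ; 1ℤ)
import Data.Integer as ℤ
open import Data.List using (List; []; _∷_; _++_; map; filter; foldr; replicate; cartesianProductWith)
open import Data.List.Relation.Unary.All using (All; []; _∷_)
import Data.List.Relation.Unary.All as All
import Data.List.Relation.Unary.All.Properties as All
open import Data.List.Relation.Unary.AllPairs using (AllPairs; []; _∷_)
import Data.List.Relation.Unary.AllPairs.Properties as AllPairs
open import Data.Nat using (ℕ; zero; suc; pred; _+_; _≤_; _<_; _⊔_; s≤s⁻¹; >-nonZero)
import Data.Nat.Properties as ℕ
open import Data.Product using (∃; _×_; _,_; proj₁; proj₂)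
open import Data.Sign using (Sign)
import Data.Sign as Sign
open import Data.Vec using (Vec; []; _∷_; lookup; tabulate; updateAt; zipWith)
import Data.Vec as Vec
import Data.Vec.Properties as Vec
open import Function using (_∘_; _on_; _↔_)
open import Function.Properties.Inverse using (↔⇒↣)
open import Relation.Binary using (Rel; DecidableEquality; IsStrictTotalOrder)
open import Relation.Binary.PropositionalEquality
  using (_≡_; _≢_; refl; sym; trans; cong; subst; module ≡-Reasoning)
open import Relation.Nullary using (Dec; yes; no; does)
open import Relation.Nullary.Decidable using (_×-dec_; _→-dec_; via-injection)
open import Data.Bool using (if_then_else_)

private
  variable
    n l : ℕ

Monomial : ℕ → Set
Monomial n = Vec ℕ n

unit : Monomial n
unit = Vec.replicate _ 0

_≟ᵐ_ : DecidableEquality (Monomial n)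
_≟ᵐ_ = Vec.≡-dec ℕ._≟_

-- A pair (c , m) is the term c · m.
PolyTerm : ℕ → Set
PolyTerm n = ℤ × Monomial n

-- A list of terms stands for their sum; like terms need not be combined.
PolyExpr : ℕ → Set
PolyExpr n = List (PolyTerm n)

coeff : PolyExpr n → Monomial n → ℤ
coeff []            m = 0ℤ
coeff ((c , m′) ∷ e) m = (if does (m′ ≟ᵐ m) then c else 0ℤ) ℤ.+ coeff e m

infix  4 _≈ᵖ_
infixl 6 _-ᵖ_

-- Equality of polynomials (in the polynomial ring, not of the lists).
_≈ᵖ_ : Rel (PolyExpr n) 0ℓ
e ≈ᵖ e′ = ∀ m → coeff e m ≡ coeff e′ m

_-ᵖ_ : PolyExpr n → PolyExpr n → PolyExpr n
e -ᵖ e′ = e ++ map (λ (c , m) → ℤ.- c , m) e′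

polySemiring : ℕ → RawSemiring 0ℓ 0ℓ
polySemiring n = record
  { Carrier = PolyExpr n
  ; _≈_     = _≈ᵖ_
  ; _+_     = _++_
  ; _*_     = cartesianProductWith (λ (c , m) (d , k) → c ℤ.* d , zipWith _+_ m k)
  ; 0#      = []
  ; 1#      = (1ℤ , unit) ∷ []
  }

unknowns : Vec (PolyExpr n) n
unknowns = tabulate λ i → (1ℤ , updateAt unit i suc) ∷ []

-- The reduced form; the order in which the terms are listed is immaterial.
record Polynomial (n : ℕ) : Set where
  field
    terms    : PolyExpr n
    nonzero  : All ((_≢ 0ℤ) ∘ proj₁) terms
    distinct : AllPairs (_≢_ on proj₂) terms

open Polynomial public

constantTerm : Polynomial n → ℤ
constantTerm p = coeff (terms p) unit

-- In reduced form, p = p₀ iff no monomial other than 1 occurs in p.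
IsConstant : Polynomial n → Set
IsConstant p = All ((_≡ unit) ∘ proj₂) (terms p)

isConstant? : (p : Polynomial n) → Dec (IsConstant p)
isConstant? p = All.all? ((_≟ᵐ unit) ∘ proj₂) (terms p)

record VariableOrder (n : ℕ) : Set₁ where
  infix 4 _≺_
  field
    _≺_                : Rel (Fin n) 0ℓ
    isStrictTotalOrder : IsStrictTotalOrder _≡_ _≺_
  open IsStrictTotalOrder isStrictTotalOrder public using () renaming (_<?_ to _≺?_)

module _ (o : VariableOrder n) (j : Fin n) where
  open VariableOrder o

  -- The monomial is divisible by x_j and by no x_i with x_i ≺ x_j.
  InGroup : PolyTerm n → Set
  InGroup (_ , m) = (0 < lookup m j) × (∀ i → i ≺ j → lookup m i ≡ 0)

  inGroup? : (t : PolyTerm n) → Dec (InGroup t)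
  inGroup? (_ , m) =
    (0 ℕ.<? lookup m j) ×-dec Fin.all? (λ i → (i ≺? j) →-dec (lookup m i ℕ.≟ 0))

  -- p_{x_j}
  group : PolyExpr n → PolyExpr n
  group = filter inGroup?

divideBy : Fin n → PolyTerm n → PolyTerm n
divideBy j (c , m) = c , updateAt m j pred

multiply-divide : (m : Monomial n) (j : Fin n) → 0 < lookup m j →
                  updateAt (updateAt m j pred) j suc ≡ m
multiply-divide m j 0<mⱼ = trans
  (Vec.updateAt-updateAt j m)
  (Vec.updateAt-id-local j m (ℕ.suc-pred (lookup m j) {{>-nonZero 0<mⱼ}}))

divide-injective : (m k : Monomial n) (j : Fin n) → 0 < lookup m j → 0 < lookup k j →
                   updateAt m j pred ≡ updateAt k j pred → m ≡ k
divide-injective m k j 0<mⱼ 0<kⱼ eq = begin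
  m                                    ≡⟨ multiply-divide m j 0<mⱼ ⟨
  updateAt (updateAt m j pred) j suc   ≡⟨ cong (λ v → updateAt v j suc) eq ⟩
  updateAt (updateAt k j pred) j suc   ≡⟨ multiply-divide k j 0<kⱼ ⟩
  k                                    ∎
  where open ≡-Reasoning

divide-distinct : (j : Fin n) {e : PolyExpr n} → All ((0 <_) ∘ (λ m → lookup m j) ∘ proj₂) e →
                  AllPairs (_≢_ on proj₂) e → AllPairs (_≢_ on proj₂) (map (divideBy j) e)
divide-distinct j []         []         = []
divide-distinct j (px ∷ pxs) (dx ∷ dxs) =
  All.map⁺ (All.zipWith (λ (py , d) → d ∘ divide-injective _ _ j px py) (pxs , dx))
  ∷ divide-distinct j pxs dxs

-- p_{x_j}↓, the p′ with p_{x_j} = x_j · p′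
reduction : VariableOrder n → Polynomial n → Fin n → Polynomial n
reduction o p j = record
  { terms    = map (divideBy j) (group o j (terms p))
  ; nonzero  = All.map⁺ (All.filter⁺ (inGroup? o j) (nonzero p))
  ; distinct = divide-distinct j
      (All.map proj₁ (All.all-filter (inGroup? o j) (terms p)))
      (AllPairs.filter⁺ (inGroup? o j) (distinct p))
  }

totalDegree : PolyTerm n → ℕ
totalDegree (_ , m) = Vec.sum m

DegreeBound : ℕ → Polynomial n → Set
DegreeBound d p = All ((_≤ d) ∘ totalDegree) (terms p)

degree : Polynomial n → ℕ
degree p = foldr (λ t d → totalDegree t ⊔ d) 0 (terms p)

degree-bound : (p : Polynomial n) → DegreeBound (degree p) p
degree-bound p = go (terms p)
  where
  go : (e : PolyExpr n) →
       All ((_≤ foldr (λ t d → totalDegree t ⊔ d) 0 e) ∘ totalDegree) e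
  go []      = []
  go (t ∷ e) = ℕ.m≤m⊔n (totalDegree t) _
             ∷ All.map (λ le → ℕ.≤-trans le (ℕ.m≤n⊔m (totalDegree t) _)) (go e)

sum-divide : (m : Monomial n) (j : Fin n) → 0 < lookup m j →
             suc (Vec.sum (updateAt m j pred)) ≡ Vec.sum m
sum-divide (suc x ∷ m) zero    _    = refl
sum-divide (x ∷ m)     (suc j) 0<mⱼ =
  trans (sym (ℕ.+-suc x _)) (cong (x +_) (sum-divide m j 0<mⱼ))

reduction-bound : (o : VariableOrder n) (p : Polynomial n) (j : Fin n) {d : ℕ} →
                  DegreeBound (suc d) p → DegreeBound d (reduction o p j)
reduction-bound o p j bound = All.map⁺ (All.zipWith
  (λ {t} ((0<mⱼ , _) , le) → s≤s⁻¹ (subst (_≤ _) (sym (sum-divide (proj₂ t) j 0<mⱼ)) le))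
  (All.all-filter (inGroup? o j) (terms p) , All.filter⁺ (inGroup? o j) bound))

record Signature : Set₁ where
  field
    Op     : ℕ → Set
    finite : ∃ λ k → ∃ Op ↔ Fin k
    g      : Op 2
    a      : Op 0

  Symbol : Set
  Symbol = ∃ Op

  _≟ˢ_ : DecidableEquality Symbol
  _≟ˢ_ = via-injection (↔⇒↣ (proj₂ finite)) Fin._≟_

module _ (S : Signature) where
  open Signature S

  -- Ground terms over the signature and one function variable F of arity n.
  data Term (n : ℕ) : Set where
    op : Op l → Vec (Term n) l → Term n
    F  : Vec (Term n) n → Term n

  aᵗ : Term n
  aᵗ = op a []

  gᵗ : Term n → Term n → Term n
  gᵗ s t = op g (s ∷ t ∷ [])

  -- The flattened term g(u₁,…,uₘ,t), nested to the right; just t when m = 0.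
  gFlat : List (Term n) → Term n → Term n
  gFlat us t = foldr gᵗ t us

  -- The set 𝒜, as the set of its instances.
  data Associativity {n : ℕ} : Rel (Term n) 0ℓ where
    assoc : ∀ x y z → Associativity (gᵗ x (gᵗ y z)) (gᵗ (gᵗ x y) z)

  -- A problem (𝒰, 𝒜, F) whose function variable F has arity n; an equation
  -- is the pair of its left-hand and right-hand side.
  record Problem (n : ℕ) : Set₁ where
    field
      equations : List (Term n × Term n)
      axioms    : Rel (Term n) 0ℓ

  open Problem public

  -- g(a^|c|, t) if c has the given sign, and t otherwise; for t = a the
  -- former is g(a^(|c|+1)).
  prefix : Sign → ℤ → Term n → Term n
  prefix Sign.+ +[1+ k ] t = gFlat (replicate (suc k) aᵗ) t
  prefix Sign.- -[1+ k ] t = gFlat (replicate (suc k) aᵗ) t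
  prefix _      _        t = t

  module _ (order : Polynomial n → VariableOrder n) where

    -- Recursion on a bound for the degree of p; the bound 0 forces p to be constant.
    cvtBounded : (d : ℕ) (p : Polynomial n) → DegreeBound d p → Sign → Term n
    cvtBounded zero    p _     ⋆ = prefix ⋆ (constantTerm p) aᵗ
    cvtBounded (suc d) p bound ⋆ with isConstant? p
    ... | yes _ = prefix ⋆ (constantTerm p) aᵗ
    ... | no  _ = prefix ⋆ (constantTerm p) (F (tabulate λ i →
      cvtBounded d (reduction (order p) p i) (reduction-bound (order p) p i bound) ⋆))

    cvt : Polynomial n → Sign → Term n
    cvt p = cvtBounded (degree p) p (degree-bound p)

    inducedProblem : Polynomial n → Problem n
    inducedProblem p = record
      { equations = (cvt p Sign.- , cvt p Sign.+) ∷ []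
      ; axioms    = Associativity
      }

  -- The values h lie in an arbitrary semiring: ℕ for numerical values, or
  -- the polynomials when h consists of the unknowns.
  module _ {c ℓ : Level} (R : RawSemiring c ℓ) where
    open RawSemiring R using (Carrier; 0#; 1#) renaming (_+_ to _⊕_; _*_ to _⊛_)

    sumʳ : Vec Carrier l → Carrier
    sumʳ = Vec.foldr′ _⊕_ 0#

    dot : Vec Carrier l → Vec Carrier l → Carrier
    dot hs vs = sumʳ (zipWith _⊛_ hs vs)

    mutual
      mul : Vec Carrier n → Term n → Carrier
      mul h (op f ts) = sumʳ (mulAll h ts)
      mul h (F ts)    = 1# ⊕ dot h (mulAll h ts)

      -- Vec.map (mul h)
      mulAll : Vec Carrier n → Vec (Term n) l → Vec Carrier l
      mulAll h []       = []
      mulAll h (t ∷ ts) = mul h t ∷ mulAll h ts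

    mutual
      cnt : Vec Carrier n → Symbol → Term n → Carrier
      cnt h b (op f ts) = (if does ((_ , f) ≟ˢ b) then 1# else 0#) ⊕ sumʳ (cntAll h b ts)
      cnt h b (F ts)    = dot h (cntAll h b ts)

      -- Vec.map (cnt h b)
      cntAll : Vec Carrier n → Symbol → Vec (Term n) l → Vec Carrier l
      cntAll h b []       = []
      cntAll h b (t ∷ ts) = cnt h b t ∷ cntAll h b ts

    total : (Term n × Term n → Carrier) → Problem n → Carrier
    total v U = foldr (λ e s → v e ⊕ s) 0# (equations U)

    mulₗ mulᵣ : Vec Carrier n → Problem n → Carrier
    mulₗ h = total (mul h ∘ proj₁)
    mulᵣ h = total (mul h ∘ proj₂)

    cntₗ cntᵣ : Vec Carrier n → Symbol → Problem n → Carrier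
    cntₗ h b = total (cnt h b ∘ proj₁)
    cntᵣ h b = total (cnt h b ∘ proj₂)

{-# OPTIONS --safe #-}

-- The multipliers agree since both converters have the same occurrences of F. For
-- the counters, the numbers of leading a's differ by p₀ and, inductively, the i-th
-- arguments of F contribute xᵢ · p_{xᵢ}↓ = p_{xᵢ}; the groups p_{xᵢ} add up to p - p₀
-- because a monomial other than 1 lies in the group of the least variable dividing it
-- and in no other.
module Submission where

open import Algebra.Bundles.Raw using (RawSemiring)
import Algebra.Properties.CommutativeMonoid.Sum as Sum
import Algebra.Properties.CommutativeSemigroup as CommutativeSemigroup
open import Data.Bool using (true; false; if_then_else_)
open import Data.Fin using (Fin; zero; suc)
import Data.Fin.Properties as Fin
open import Data.Fin.Induction using (spo-wellFounded)
open import Data.Integer using (ℤ; +_; +[1+_]; -[1+_]; 0ℤ; 1ℤ) renaming (_+_ to _+ᶻ_; -_ to -ᶻ_)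
import Data.Integer.Properties as ℤ
open import Data.List using ([]; _∷_; _++_; map; filter; replicate)
import Data.List.Properties as List
open import Data.List.Relation.Unary.All using (All; []; _∷_)
import Data.List.Relation.Unary.All as All
import Data.List.Relation.Unary.All.Properties as All
open import Data.Nat using (ℕ; zero; suc; pred; _+_; _≤_; _<_)
import Data.Nat.Properties as ℕ
open import Data.Product using (_×_; _,_; proj₁; proj₂; ∃)
open import Data.Sign using (Sign)
open import Data.Vec using (Vec; []; _∷_; lookup; tabulate; updateAt; zipWith)
import Data.Vec as Vec
import Data.Vec.Properties as Vec
open import Function using (_∘_; mk⇔; _⇔_)
open import Induction.WellFounded using (Acc; acc)
open import Level using (0ℓ)
open import Relation.Binary using (IsStrictTotalOrder; tri<; tri≈; tri>)
open import Relation.Binary.PropositionalEquality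
  using (_≡_; _≢_; _≗_; refl; sym; trans; cong; cong₂; subst; module ≡-Reasoning)
open import Relation.Nullary using (Dec; yes; no; does; contradiction)
open import Relation.Nullary.Decidable using (dec-true; dec-false; does-⇔; _×-dec_)
open import Relation.Unary using (Pred; Decidable)
open import Defs

open CommutativeSemigroup ℤ.+-commutativeSemigroup using (interchange)
open Sum ℤ.+-0-commutativeMonoid using (sum; sum-cong-≗; sum-replicate-zero; ∑-distrib-+)

private
  variable
    n l : ℕ

-- Coefficients of sums, differences and filtered lists

open module PolySemiring {n : ℕ} = RawSemiring (polySemiring n)
  using () renaming (_*_ to _*ᵖ_; 1# to 1ᵖ)

-- The coefficient at `m` of the single term c · m′. The head of a list contributes exactly this to
-- `coeff`, and `at unit m c` is the coefficient of the constant polynomial c.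
at : Monomial n → Monomial n → ℤ → ℤ
at m′ m c = if does (m′ ≟ᵐ m) then c else 0ℤ

at-+ : (m′ m : Monomial n) (c d : ℤ) → at m′ m (c +ᶻ d) ≡ at m′ m c +ᶻ at m′ m d
at-+ m′ m c d with does (m′ ≟ᵐ m)
... | true  = refl
... | false = refl

at-neg : (m′ m : Monomial n) (c : ℤ) → at m′ m (-ᶻ c) ≡ -ᶻ at m′ m c
at-neg m′ m c with does (m′ ≟ᵐ m)
... | true  = refl
... | false = refl

coeff-++ : (e e′ : PolyExpr n) (m : Monomial n) → coeff (e ++ e′) m ≡ coeff e m +ᶻ coeff e′ m
coeff-++ []             e′ m = sym (ℤ.+-identityˡ _)
coeff-++ ((c , m′) ∷ e) e′ m =
  trans (cong (at m′ m c +ᶻ_) (coeff-++ e e′ m)) (sym (ℤ.+-assoc (at m′ m c) _ _))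

coeff-neg : (e : PolyExpr n) (m : Monomial n) →
            coeff (map (λ (c , m′) → -ᶻ c , m′) e) m ≡ -ᶻ coeff e m
coeff-neg []             m = refl
coeff-neg ((c , m′) ∷ e) m =
  trans (cong₂ _+ᶻ_ (at-neg m′ m c) (coeff-neg e m)) (sym (ℤ.neg-distrib-+ (at m′ m c) _))

coeff--ᵖ : (e e′ : PolyExpr n) (m : Monomial n) →
           coeff (e -ᵖ e′) m ≡ coeff e m +ᶻ -ᶻ coeff e′ m
coeff--ᵖ e e′ m = trans (coeff-++ e _ m) (cong (coeff e m +ᶻ_) (coeff-neg e′ m))

-- The predicate sees only the monomial, so all terms with monomial `m` are kept or dropped
-- together, while terms with other monomials add zero either way.
coeff-filter : {P : Pred (Monomial n) 0ℓ} (P? : Decidable P) (e : PolyExpr n) (m : Monomial n) →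
               coeff (filter (P? ∘ proj₂) e) m ≡ (if does (P? m) then coeff e m else 0ℤ)
coeff-filter P? [] m with does (P? m)
... | true  = refl
... | false = refl
coeff-filter P? ((c , m′) ∷ e) m with m′ ≟ᵐ m | coeff-filter P? e m
coeff-filter P? ((c , m′) ∷ e) m | yes refl | ih with does (P? m)
... | true  rewrite dec-true (m ≟ᵐ m) refl = cong (c +ᶻ_) ih
... | false = ih
coeff-filter P? ((c , m′) ∷ e) m | no m′≢m | ih with does (P? m′)
... | true  rewrite dec-false (m′ ≟ᵐ m) m′≢m = begin
  0ℤ +ᶻ coeff (filter (P? ∘ proj₂) e) m                    ≡⟨ ℤ.+-identityˡ _ ⟩
  coeff (filter (P? ∘ proj₂) e) m                          ≡⟨ ih ⟩
  (if does (P? m) then coeff e m else 0ℤ)                  ≡⟨ cong (if does (P? m) then_else 0ℤ) (ℤ.+-identityˡ _) ⟨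
  (if does (P? m) then 0ℤ +ᶻ coeff e m else 0ℤ)            ∎
  where open ≡-Reasoning
... | false = trans ih (cong (if does (P? m) then_else 0ℤ) (sym (ℤ.+-identityˡ _)))

coeff-constant : {e : PolyExpr n} → All ((_≡ unit) ∘ proj₂) e →
                 (m : Monomial n) → coeff e m ≡ at unit m (coeff e unit)
coeff-constant {n = n} [] m with does (unit {n} ≟ᵐ m)
... | true  = refl
... | false = refl
coeff-constant {n = n} {e = (c , _) ∷ e} (refl ∷ pxs) m = begin
  at unit m c +ᶻ coeff e m                        ≡⟨ cong (at unit m c +ᶻ_) (coeff-constant pxs m) ⟩
  at unit m c +ᶻ at unit m (coeff e unit)         ≡⟨ at-+ unit m c _ ⟨
  at unit m (c +ᶻ coeff e unit)                   ≡⟨ cong (λ z → at unit m (z +ᶻ coeff e unit)) at-unit ⟨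
  at unit m (at (unit {n}) unit c +ᶻ coeff e unit)      ∎
  where
  open ≡-Reasoning
  at-unit : at (unit {n}) unit c ≡ c
  at-unit = cong (if_then c else 0ℤ) (dec-true (unit {n} ≟ᵐ unit) refl)

-- Multiplication by an unknown

unknown : Fin n → PolyExpr n
unknown i = (1ℤ , updateAt unit i suc) ∷ []

updateAt-unit-+ : (i : Fin n) (m : Monomial n) →
                  zipWith _+_ (updateAt unit i suc) m ≡ updateAt m i suc
updateAt-unit-+ zero    (x ∷ m) = cong (suc x ∷_) (Vec.zipWith-identityˡ ℕ.+-identityˡ m)
updateAt-unit-+ (suc i) (x ∷ m) = cong (x ∷_) (updateAt-unit-+ i m)

multiply : Fin n → PolyTerm n → PolyTerm n
multiply i (c , m) = c , updateAt m i suc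

-- The left factor has a single term, so the product is a map over `e`, and the two lists are equal,
-- not only the polynomials.
unknown-* : (i : Fin n) (e : PolyExpr n) → unknown i *ᵖ e ≡ map (multiply i) e
unknown-* i e = trans (List.++-identityʳ _)
  (List.map-cong (λ (c , m) → cong₂ _,_ (ℤ.*-identityˡ c) (updateAt-unit-+ i m)) e)

-- Multiplication by xᵢ seen on coefficient functions: the coefficient at `m` is taken from m / xᵢ,
-- and is 0 if xᵢ does not divide `m`.
shift : Fin n → (Monomial n → ℤ) → Monomial n → ℤ
shift i f m = if does (0 ℕ.<? lookup m i) then f (updateAt m i pred) else 0ℤ

-- The decomposition of `f` is a pointwise hypothesis, so an induction hypothesis quantified over
-- all monomials can be passed in directly.
shift-+ : (i : Fin n) {f : Monomial n → ℤ} (f₁ f₂ : Monomial n → ℤ) → (∀ m → f m ≡ f₁ m +ᶻ f₂ m) →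
          ∀ m → shift i f m ≡ shift i f₁ m +ᶻ shift i f₂ m
shift-+ i f₁ f₂ f≡f₁+f₂ m with does (0 ℕ.<? lookup m i)
... | true  = f≡f₁+f₂ _
... | false = refl

-- The positivity condition matters because `pred` fixes 0: without it, a monomial not divisible by
-- xᵢ would count as its own quotient.
multiply-⇔ : (i : Fin n) (k m : Monomial n) →
             updateAt k i suc ≡ m ⇔ (0 < lookup m i × k ≡ updateAt m i pred)
multiply-⇔ i k m = mk⇔
  (λ { refl → subst (0 <_) (sym (Vec.lookup∘updateAt i k)) (ℕ.0<1+n)
            , sym (trans (Vec.updateAt-updateAt i k) (Vec.updateAt-id i k)) })
  (λ { (0<mᵢ , refl) → multiply-divide m i 0<mᵢ })

coeff-multiply : (i : Fin n) (e : PolyExpr n) → coeff (map (multiply i) e) ≗ shift i (coeff e)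
coeff-multiply i [] m with does (0 ℕ.<? lookup m i)
... | true  = refl
... | false = refl
coeff-multiply i ((c , k) ∷ e) m
  -- The test made by `coeff` becomes a conjunction whose first half is the test made by `shift`;
  -- deciding that half makes both sides compute to the same value.
  rewrite does-⇔ (multiply-⇔ i k m) (updateAt k i suc ≟ᵐ m)
            ((0 ℕ.<? lookup m i) ×-dec (k ≟ᵐ updateAt m i pred))
        | coeff-multiply i e m
  with does (0 ℕ.<? lookup m i)
... | true  = refl
... | false = refl

coeff-unknown-* : (i : Fin n) (e : PolyExpr n) → coeff (unknown i *ᵖ e) ≗ shift i (coeff e)
coeff-unknown-* i e m = trans (cong (λ e′ → coeff e′ m) (unknown-* i e)) (coeff-multiply i e m)

-- Monomial groups

multiply-divide-group : (j : Fin n) {e : PolyExpr n} →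
  All ((0 <_) ∘ (λ m → lookup m j) ∘ proj₂) e → map (multiply j) (map (divideBy j) e) ≡ e
multiply-divide-group j []                          = refl
multiply-divide-group j (_∷_ {x = c , m} 0<mⱼ 0<e)  =
  cong₂ _∷_ (cong (c ,_) (multiply-divide m j 0<mⱼ)) (multiply-divide-group j 0<e)

all-zero⇒unit : (m : Monomial n) → (∀ i → lookup m i ≡ 0) → m ≡ unit
all-zero⇒unit []      _   = refl
all-zero⇒unit (x ∷ m) m≡0 = cong₂ _∷_ (m≡0 zero) (all-zero⇒unit m (m≡0 ∘ suc))

sum-single : (i : Fin n) (f : Fin n → ℤ) → (∀ j → j ≢ i → f j ≡ 0ℤ) → sum f ≡ f i
sum-single {suc n} zero    f f≡0 = trans
  (cong (f zero +ᶻ_) (trans (sum-cong-≗ (λ j → f≡0 (suc j) (λ ()))) (sum-replicate-zero n)))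
  (ℤ.+-identityʳ _)
sum-single {suc n} (suc i) f f≡0 = trans
  (cong₂ _+ᶻ_ (f≡0 zero (λ ())) (sum-single i (f ∘ suc) (λ j j≢i → f≡0 (suc j) (j≢i ∘ Fin.suc-injective))))
  (ℤ.+-identityˡ _)

module _ (o : VariableOrder n) where
  open VariableOrder o
  open IsStrictTotalOrder isStrictTotalOrder using (compare; isStrictPartialOrder)

  -- Group membership ignores the coefficient, so `0ℤ` is a mere placeholder. This makes `group` a
  -- filter on monomials, as `coeff-filter` requires.
  InGroupᵐ : Monomial n → Fin n → Set
  InGroupᵐ m j = InGroup o j (0ℤ , m)

  inGroupᵐ? : (j : Fin n) (m : Monomial n) → Dec (InGroupᵐ m j)
  inGroupᵐ? j m = inGroup? o j (0ℤ , m)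

  -- If the two variables differed, the minimality of the larger one would force the exponent of the
  -- smaller one to be 0.
  inGroup-unique : (m : Monomial n) {i j : Fin n} → InGroupᵐ m i → InGroupᵐ m j → j ≡ i
  inGroup-unique m {i} {j} (0<mᵢ , i-least) (0<mⱼ , j-least) with compare j i
  ... | tri< j≺i _ _ = contradiction (i-least j j≺i) (ℕ.m<n⇒n≢0 0<mⱼ)
  ... | tri≈ _ j≡i _ = j≡i
  ... | tri> _ _ i≺j = contradiction (j-least i i≺j) (ℕ.m<n⇒n≢0 0<mᵢ)

  -- Descent along `_≺_`: as long as a smaller variable divides `m`, move on to it. The descent ends
  -- because a strict order on a finite set is well-founded.
  least-variable : (m : Monomial n) (i : Fin n) → Acc _≺_ i → 0 < lookup m i → ∃ (InGroupᵐ m)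
  least-variable m i (acc rec) 0<mᵢ with Fin.any? (λ j → (j ≺? i) ×-dec (0 ℕ.<? lookup m j))
  ... | yes (j , j≺i , 0<mⱼ) = least-variable m j (rec j≺i) 0<mⱼ
  ... | no  none = i , 0<mᵢ , λ j j≺i → ℕ.n≤0⇒n≡0 (ℕ.≮⇒≥ (λ 0<mⱼ → none (j , j≺i , 0<mⱼ)))

  inGroup-exists : (m : Monomial n) → m ≢ unit → ∃ (InGroupᵐ m)
  inGroup-exists m m≢1 with Fin.any? (λ i → 0 ℕ.<? lookup m i)
  ... | yes (i , 0<mᵢ) = least-variable m i (spo-wellFounded isStrictPartialOrder i) 0<mᵢ
  ... | no  none = contradiction
    (all-zero⇒unit m λ i → ℕ.n≤0⇒n≡0 (ℕ.≮⇒≥ (λ 0<mᵢ → none (i , 0<mᵢ)))) m≢1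

  coeff-group : (j : Fin n) (e : PolyExpr n) (m : Monomial n) →
                coeff (group o j e) m ≡ (if does (inGroupᵐ? j m) then coeff e m else 0ℤ)
  coeff-group j = coeff-filter (inGroupᵐ? j)

  -- The identity p = p₀ + Σ p_{xᵢ}, coefficient by coefficient. At `unit` every group vanishes; at
  -- any other monomial exactly one summand survives, and it carries the full coefficient.
  grouping : (p : Polynomial n) (m : Monomial n) →
    coeff (terms p) m ≡ at unit m (constantTerm p) +ᶻ sum (λ i → coeff (group o i (terms p)) m)
  grouping p m with unit ≟ᵐ m
  ... | yes refl = sym (trans (cong (constantTerm p +ᶻ_) (trans (sum-cong-≗ vanish) (sum-replicate-zero n))) (ℤ.+-identityʳ _))
    where
    vanish : ∀ i → coeff (group o i (terms p)) unit ≡ 0ℤ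
    vanish i = trans (coeff-group i (terms p) unit) (cong (if_then constantTerm p else 0ℤ)
      (dec-false (inGroupᵐ? i unit) λ (0<1ᵢ , _) → ℕ.m<n⇒n≢0 0<1ᵢ (Vec.lookup-replicate i 0)))
  ... | no 1≢m with inGroup-exists m (1≢m ∘ sym)
  ... | i , m∈i = sym (trans (ℤ.+-identityˡ _) (trans (sum-single i _ vanish) single))
    where
    single : coeff (group o i (terms p)) m ≡ coeff (terms p) m
    single = trans (coeff-group i (terms p) m)
      (cong (if_then coeff (terms p) m else 0ℤ) (dec-true (inGroupᵐ? i m) m∈i))
    vanish : ∀ j → j ≢ i → coeff (group o j (terms p)) m ≡ 0ℤ
    vanish j j≢i = trans (coeff-group j (terms p) m) (cong (if_then coeff (terms p) m else 0ℤ)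
      (dec-false (inGroupᵐ? j m) (j≢i ∘ inGroup-unique m m∈i)))

  -- This is xⱼ · p_{xⱼ}↓ = p_{xⱼ}: every monomial of the group is divisible by xⱼ, so multiplying
  -- back undoes the division.
  shift-reduction : (p : Polynomial n) (j : Fin n) →
                        shift j (coeff (terms (reduction o p j))) ≗ coeff (group o j (terms p))
  shift-reduction p j m = trans (sym (coeff-multiply j (terms (reduction o p j)) m))
    (cong (λ e → coeff e m) (multiply-divide-group j {group o j (terms p)}
      (All.map proj₁ (All.all-filter (inGroup? o j) (terms p)))))

-- Leading constants of the converters and their counters

signedPart : Sign → ℤ → ℕ
signedPart Sign.+ +[1+ k ] = suc k
signedPart Sign.- -[1+ k ] = suc k
signedPart _      _        = 0

-- An integer is its positive part minus its negative part, written additively so that it fits the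
-- later sums.
signedPart-difference : (c : ℤ) → + signedPart Sign.+ c ≡ c +ᶻ + signedPart Sign.- c
signedPart-difference (+ zero)   = refl
signedPart-difference +[1+ k ]   = sym (ℤ.+-identityʳ +[1+ k ])
signedPart-difference -[1+ k ]   = sym (ℤ.+-inverseˡ +[1+ k ])

module _ (S : Signature) where
  open Signature S using (Symbol; g; a; _≟ˢ_)

  aˢ : Symbol
  aˢ = 0 , a

  cntᵖ : Term S n → PolyExpr n
  cntᵖ {n} = cnt S (polySemiring n) unknowns aˢ

  mulᵖ : Term S n → PolyExpr n
  mulᵖ {n} = mul S (polySemiring n) unknowns

  coeff-cnt-a : (m : Monomial n) → coeff (cntᵖ (aᵗ S)) m ≡ at unit m 1ℤ
  coeff-cnt-a m rewrite dec-true (aˢ ≟ˢ aˢ) refl = ℤ.+-identityʳ _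

  coeff-cnt-g : (s t : Term S n) (m : Monomial n) →
                coeff (cntᵖ (gᵗ S s t)) m ≡ coeff (cntᵖ s) m +ᶻ coeff (cntᵖ t) m
  -- The symbols `g` and `a` differ already in their arities.
  coeff-cnt-g s t m rewrite dec-false ((2 , g) ≟ˢ aˢ) (λ ()) =
    trans (coeff-++ (cntᵖ s) _ m)
      (cong (λ e → coeff (cntᵖ s) m +ᶻ coeff e m) (List.++-identityʳ (cntᵖ t)))

  coeff-cnt-gFlat : (k : ℕ) (t : Term S n) (m : Monomial n) →
    coeff (cntᵖ (gFlat S (replicate k (aᵗ S)) t)) m ≡ at unit m (+ k) +ᶻ coeff (cntᵖ t) m
  coeff-cnt-gFlat {n} zero t m with does (unit {n} ≟ᵐ m)
  ... | true  = sym (ℤ.+-identityˡ _)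
  ... | false = sym (ℤ.+-identityˡ _)
  coeff-cnt-gFlat (suc k) t m = begin
    coeff (cntᵖ (gᵗ S (aᵗ S) t′)) m                                 ≡⟨ coeff-cnt-g (aᵗ S) t′ m ⟩
    coeff (cntᵖ (aᵗ S)) m +ᶻ coeff (cntᵖ t′) m                      ≡⟨ cong₂ _+ᶻ_ (coeff-cnt-a m) (coeff-cnt-gFlat k t m) ⟩
    at unit m 1ℤ +ᶻ (at unit m (+ k) +ᶻ coeff (cntᵖ t) m)           ≡⟨ ℤ.+-assoc (at unit m 1ℤ) _ _ ⟨
    (at unit m 1ℤ +ᶻ at unit m (+ k)) +ᶻ coeff (cntᵖ t) m           ≡⟨ cong (_+ᶻ coeff (cntᵖ t) m) (at-+ unit m 1ℤ (+ k)) ⟨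
    at unit m (+ suc k) +ᶻ coeff (cntᵖ t) m                         ∎
    where
    open ≡-Reasoning
    t′ = gFlat S (replicate k (aᵗ S)) t

  -- A uniform form of `prefix`, covering the case of no added symbols by `k = 0`; later arguments
  -- then need no case distinction on sign and constant.
  prefix-gFlat : (⋆ : Sign) (c : ℤ) (t : Term S n) →
                 prefix S ⋆ c t ≡ gFlat S (replicate (signedPart ⋆ c) (aᵗ S)) t
  prefix-gFlat Sign.+ (+ zero)   t = refl
  prefix-gFlat Sign.+ +[1+ k ]   t = refl
  prefix-gFlat Sign.+ -[1+ k ]   t = refl
  prefix-gFlat Sign.- (+ zero)   t = refl
  prefix-gFlat Sign.- +[1+ k ]   t = refl
  prefix-gFlat Sign.- -[1+ k ]   t = refl

  coeff-cnt-prefix : (⋆ : Sign) (c : ℤ) (t : Term S n) (m : Monomial n) →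
    coeff (cntᵖ (prefix S ⋆ c t)) m ≡ at unit m (+ signedPart ⋆ c) +ᶻ coeff (cntᵖ t) m
  coeff-cnt-prefix ⋆ c t m rewrite prefix-gFlat ⋆ c t = coeff-cnt-gFlat (signedPart ⋆ c) t m

  -- The leading constants account for a difference of `c`, and `z` is the difference of the terms
  -- behind them: zero when both are `a`, the sum of the groups when both are applications of `F`.
  cnt-prefix-difference : (c : ℤ) (s t : Term S n) (m : Monomial n) (z : ℤ) →
    coeff (cntᵖ s) m ≡ z +ᶻ coeff (cntᵖ t) m →
    coeff (cntᵖ (prefix S Sign.+ c s)) m
      ≡ (at unit m c +ᶻ z) +ᶻ coeff (cntᵖ (prefix S Sign.- c t)) m
  cnt-prefix-difference c s t m z s≡z+t = begin
    coeff (cntᵖ (prefix S Sign.+ c s)) m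
      ≡⟨ coeff-cnt-prefix Sign.+ c s m ⟩
    at unit m (+ signedPart Sign.+ c) +ᶻ coeff (cntᵖ s) m
      ≡⟨ cong₂ _+ᶻ_ (trans (cong (at unit m) (signedPart-difference c)) (at-+ unit m c _)) s≡z+t ⟩
    (at unit m c +ᶻ at unit m (+ signedPart Sign.- c)) +ᶻ (z +ᶻ coeff (cntᵖ t) m)
      ≡⟨ interchange (at unit m c) _ z _ ⟩
    (at unit m c +ᶻ z) +ᶻ (at unit m (+ signedPart Sign.- c) +ᶻ coeff (cntᵖ t) m)
      ≡⟨ cong ((at unit m c +ᶻ z) +ᶻ_) (coeff-cnt-prefix Sign.- c t m) ⟨
    (at unit m c +ᶻ z) +ᶻ coeff (cntᵖ (prefix S Sign.- c t)) m
      ∎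
    where open ≡-Reasoning

  -- Counter of an application of the function variable

  coeff-dot : (hs vs : Vec (PolyExpr n) l) (m : Monomial n) →
    coeff (dot S (polySemiring n) hs vs) m ≡ sum (λ i → coeff (lookup hs i *ᵖ lookup vs i) m)
  coeff-dot []       []       m = refl
  coeff-dot (h ∷ hs) (v ∷ vs) m =
    trans (coeff-++ (h *ᵖ v) _ m) (cong (coeff (h *ᵖ v) m +ᶻ_) (coeff-dot hs vs m))

  lookup-cntAll : (ts : Vec (Term S n) l) (i : Fin l) →
    lookup (cntAll S (polySemiring n) unknowns aˢ ts) i ≡ cntᵖ (lookup ts i)
  lookup-cntAll (t ∷ ts) zero    = refl
  lookup-cntAll (t ∷ ts) (suc i) = lookup-cntAll ts i

  -- The weights are the unknowns themselves, so weighting the i-th argument is a multiplication by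
  -- xᵢ, that is, a `shift`.
  coeff-cnt-F : (t : Fin n → Term S n) (m : Monomial n) →
    coeff (cntᵖ (F (tabulate t))) m ≡ sum (λ i → shift i (coeff (cntᵖ (t i))) m)
  coeff-cnt-F {n} t m = trans (coeff-dot unknowns _ m) (sum-cong-≗ λ i → trans
    (cong₂ (λ h v → coeff (h *ᵖ v) m)
      (Vec.lookup∘tabulate unknown i)
      (trans (lookup-cntAll (tabulate t) i) (cong cntᵖ (Vec.lookup∘tabulate t i))))
    (coeff-unknown-* i (cntᵖ (t i)) m))

  -- Multipliers

  mul-gFlat : (k : ℕ) (t : Term S n) → mulᵖ (gFlat S (replicate k (aᵗ S)) t) ≡ mulᵖ t
  mul-gFlat zero    t = refl
  mul-gFlat (suc k) t = trans (List.++-identityʳ _) (mul-gFlat k t)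

  -- Only occurrences of `F` contribute to the multiplier, and a prefix consists of `g` and `a`
  -- alone.
  mul-prefix : (⋆ : Sign) (c : ℤ) (t : Term S n) → mulᵖ (prefix S ⋆ c t) ≡ mulᵖ t
  mul-prefix ⋆ c t = trans (cong mulᵖ (prefix-gFlat ⋆ c t)) (mul-gFlat (signedPart ⋆ c) t)

  mulAll-tabulate : (s t : Fin l → Term S n) → (∀ i → mulᵖ (s i) ≡ mulᵖ (t i)) →
    mulAll S (polySemiring n) unknowns (tabulate s) ≡ mulAll S (polySemiring n) unknowns (tabulate t)
  mulAll-tabulate {l = zero}  s t s≡t = refl
  mulAll-tabulate {l = suc l} s t s≡t =
    cong₂ _∷_ (s≡t zero) (mulAll-tabulate (s ∘ suc) (t ∘ suc) (s≡t ∘ suc))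

  -- Induction along the converter

  module _ (order : Polynomial n → VariableOrder n) where

    -- Whether an `F` is produced, and on which reductions the recursion continues, depends on `p`
    -- and not on the sign. The multipliers therefore agree even as lists.
    mul-cvtBounded : (d : ℕ) (p : Polynomial n) (bound : DegreeBound d p) →
      mulᵖ (cvtBounded S order d p bound Sign.-) ≡ mulᵖ (cvtBounded S order d p bound Sign.+)
    mul-cvtBounded zero p bound =
      trans (mul-prefix Sign.- (constantTerm p) (aᵗ S)) (sym (mul-prefix Sign.+ (constantTerm p) (aᵗ S)))
    mul-cvtBounded (suc d) p bound with isConstant? p
    ... | yes _ =
      trans (mul-prefix Sign.- (constantTerm p) (aᵗ S)) (sym (mul-prefix Sign.+ (constantTerm p) (aᵗ S)))
    ... | no  _ = trans (mul-prefix Sign.- (constantTerm p) (F (tabulate (t Sign.-))))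
      (trans (cong (λ vs → 1ᵖ ++ dot S (polySemiring n) unknowns vs)
               (mulAll-tabulate (t Sign.-) (t Sign.+) (λ i → mul-cvtBounded d (reduction (order p) p i)
                 (reduction-bound (order p) p i bound))))
        (sym (mul-prefix Sign.+ (constantTerm p) (F (tabulate (t Sign.+))))))
      where
      t : Sign → Fin n → Term S n
      t ⋆ i = cvtBounded S order d (reduction (order p) p i) (reduction-bound (order p) p i bound) ⋆

    cnt-constant : (p : Polynomial n) → IsConstant p → (m : Monomial n) →
      coeff (cntᵖ (prefix S Sign.+ (constantTerm p) (aᵗ S))) m
        ≡ coeff (terms p) m +ᶻ coeff (cntᵖ (prefix S Sign.- (constantTerm p) (aᵗ S))) m
    cnt-constant p const m = trans
      (cnt-prefix-difference (constantTerm p) (aᵗ S) (aᵗ S) m 0ℤ (sym (ℤ.+-identityˡ _)))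
      (cong (_+ᶻ coeff (cntᵖ (prefix S Sign.- (constantTerm p) (aᵗ S))) m)
        (trans (ℤ.+-identityʳ _) (sym (coeff-constant const m))))

    -- The first claim of the theorem with the subtraction moved to the other side, for every degree
    -- bound, so that it can be applied to the reductions.
    cnt-cvtBounded : (d : ℕ) (p : Polynomial n) (bound : DegreeBound d p) (m : Monomial n) →
      coeff (cntᵖ (cvtBounded S order d p bound Sign.+)) m
        ≡ coeff (terms p) m +ᶻ coeff (cntᵖ (cvtBounded S order d p bound Sign.-)) m
    -- Exponents with sum 0 are all 0, so the bound 0 leaves only constant terms.
    cnt-cvtBounded zero p bound = cnt-constant p (All.map (sum≡0 _ ∘ ℕ.n≤0⇒n≡0) bound)
      where
      sum≡0 : (m : Monomial l) → Vec.sum m ≡ 0 → m ≡ unit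
      sum≡0 []      _  = refl
      sum≡0 (x ∷ m) eq = cong₂ _∷_ (ℕ.m+n≡0⇒m≡0 x eq) (sum≡0 m (ℕ.m+n≡0⇒n≡0 x eq))
    cnt-cvtBounded (suc d) p bound m with isConstant? p
    ... | yes const = cnt-constant p const m
    ... | no  _ = trans
      (cnt-prefix-difference (constantTerm p) (F (tabulate (t Sign.+))) (F (tabulate (t Sign.-))) m Σp step)
      (cong (_+ᶻ coeff (cntᵖ (prefix S Sign.- (constantTerm p) (F (tabulate (t Sign.-))))) m)
        (sym (grouping (order p) p m)))
      where
      t : Sign → Fin n → Term S n
      t ⋆ i = cvtBounded S order d (reduction (order p) p i) (reduction-bound (order p) p i bound) ⋆
      Σp : ℤ
      Σp = sum (λ i → coeff (group (order p) i (terms p)) m)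
      open ≡-Reasoning
      step : coeff (cntᵖ (F (tabulate (t Sign.+)))) m ≡ Σp +ᶻ coeff (cntᵖ (F (tabulate (t Sign.-)))) m
      step = begin
        coeff (cntᵖ (F (tabulate (t Sign.+)))) m
          ≡⟨ coeff-cnt-F (t Sign.+) m ⟩
        sum (λ i → shift i (coeff (cntᵖ (t Sign.+ i))) m)
          -- The induction hypothesis is needed at m / xᵢ rather than at `m`, so it is used for all
          -- monomials and carried through `shift`; the reduction then becomes the group.
          ≡⟨ sum-cong-≗ (λ i → trans
               (shift-+ i (coeff (terms (reduction (order p) p i))) (coeff (cntᵖ (t Sign.- i)))
                 (cnt-cvtBounded d (reduction (order p) p i) (reduction-bound (order p) p i bound)) m)
               (cong (_+ᶻ shift i (coeff (cntᵖ (t Sign.- i))) m) (shift-reduction (order p) p i m))) ⟩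
        sum (λ i → coeff (group (order p) i (terms p)) m +ᶻ shift i (coeff (cntᵖ (t Sign.- i))) m)
          ≡⟨ ∑-distrib-+ (λ i → coeff (group (order p) i (terms p)) m) _ ⟩
        Σp +ᶻ sum (λ i → shift i (coeff (cntᵖ (t Sign.- i))) m)
          ≡⟨ cong (Σp +ᶻ_) (coeff-cnt-F (t Sign.-) m) ⟨
        Σp +ᶻ coeff (cntᵖ (F (tabulate (t Sign.-)))) m
          ∎

theorem4p9 :
    (S : Signature) (n : ℕ) → 1 ≤ n →
    (order : Polynomial n → VariableOrder n) (p : Polynomial n) →
    let U  = inducedProblem S order p
        R  = polySemiring n
        aˢ : Signature.Symbol S
        aˢ = (0 , Signature.a S)
    in (terms p ≈ᵖ cntᵣ S R unknowns aˢ U -ᵖ cntₗ S R unknowns aˢ U)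
     × (RawSemiring.0# R ≈ᵖ mulₗ S R unknowns U -ᵖ mulᵣ S R unknowns U)
theorem4p9 S n _ order p = counters , multipliers
  where
  open ≡-Reasoning
  cnt⁻ cnt⁺ mul⁻ mul⁺ : PolyExpr n
  cnt⁻ = cntᵖ S (cvt S order p Sign.-)
  cnt⁺ = cntᵖ S (cvt S order p Sign.+)
  mul⁻ = mulᵖ S (cvt S order p Sign.-)
  mul⁺ = mulᵖ S (cvt S order p Sign.+)

  -- Each `++ []` is the empty remainder of the sum over the single equation of the problem.
  counters : terms p ≈ᵖ (cnt⁺ ++ []) -ᵖ (cnt⁻ ++ [])
  counters m = sym (begin
    coeff ((cnt⁺ ++ []) -ᵖ (cnt⁻ ++ [])) m
      ≡⟨ cong₂ (λ e e′ → coeff (e -ᵖ e′) m) (List.++-identityʳ cnt⁺) (List.++-identityʳ cnt⁻) ⟩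
    coeff (cnt⁺ -ᵖ cnt⁻) m
      ≡⟨ coeff--ᵖ cnt⁺ cnt⁻ m ⟩
    coeff cnt⁺ m +ᶻ -ᶻ coeff cnt⁻ m
      ≡⟨ cong (_+ᶻ -ᶻ coeff cnt⁻ m) (cnt-cvtBounded S order (degree p) p (degree-bound p) m) ⟩
    (coeff (terms p) m +ᶻ coeff cnt⁻ m) +ᶻ -ᶻ coeff cnt⁻ m
      ≡⟨ ℤ.+-assoc (coeff (terms p) m) _ _ ⟩
    coeff (terms p) m +ᶻ (coeff cnt⁻ m +ᶻ -ᶻ coeff cnt⁻ m)
      ≡⟨ cong (coeff (terms p) m +ᶻ_) (ℤ.+-inverseʳ (coeff cnt⁻ m)) ⟩
    coeff (terms p) m +ᶻ 0ℤ
      ≡⟨ ℤ.+-identityʳ _ ⟩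
    coeff (terms p) m
      ∎)

  multipliers : [] ≈ᵖ (mul⁻ ++ []) -ᵖ (mul⁺ ++ [])
  multipliers m = sym (begin
    coeff ((mul⁻ ++ []) -ᵖ (mul⁺ ++ [])) m
      -- As the two multipliers are equal lists, what remains is a polynomial minus itself, which
      -- cancels coefficientwise.
      ≡⟨ cong (λ e → coeff ((e ++ []) -ᵖ (mul⁺ ++ [])) m) (mul-cvtBounded S order (degree p) p (degree-bound p)) ⟩
    coeff ((mul⁺ ++ []) -ᵖ (mul⁺ ++ [])) m
      ≡⟨ coeff--ᵖ (mul⁺ ++ []) (mul⁺ ++ []) m ⟩
    coeff (mul⁺ ++ []) m +ᶻ -ᶻ coeff (mul⁺ ++ []) m
      ≡⟨ ℤ.+-inverseʳ (coeff (mul⁺ ++ []) m) ⟩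
    0ℤ
      ∎)
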